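{- For every rational number $p/q \in [4/5, 1)$ there exist infinitely many $2$-connected cubic graphs $G$ such that $m_3(G) = p/q$.
   Context: For a bridgeless cubic graph $G$, $m_3(G)$ denotes the maximum number of edges of $G$ contained in the union of three perfect matchings of $G$, divided by $|E(G)|$. -}

module Defs where

open import Data.Nat using (ℕ; _<ᵇ_)
open import Data.Fin using (Fin; toℕ)
open import Data.Bool using (Bool; true; false; _∧_; _∨_; T; not)
open import Data.List using (List; allFin; filter; length; cartesianProduct; map)
open import Data.Product using (_×_; _,_; proj₁; proj₂)
open import Relation.Binary.PropositionalEquality using (_≡_)
open import Data.Bool.Properties using (T?)

record Graph : Set where
  field
    n     : ℕ
    adj   : Fin n → Fin n → Bool
    sym   : ∀ u v → adj u v ≡ adj v u
    irref : ∀ v → adj v v ≡ false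
open Graph public

countV : ∀ {k} → (Fin k → Bool) → ℕ
countV {k} f = length (filter (λ w → T? (f w)) (allFin k))

degree : (G : Graph) → Fin (n G) → ℕ
degree G v = countV (adj G v)

Cubic : Graph → Set
Cubic G = ∀ v → degree G v ≡ 3

-- unordered pairs {u,v} represented by ordered pairs with toℕ u < toℕ v
pairs : (k : ℕ) → List (Fin k × Fin k)
pairs k = filter (λ e → T? (toℕ (proj₁ e) <ᵇ toℕ (proj₂ e)))
                 (cartesianProduct (allFin k) (allFin k))

countE : (G : Graph) → (Fin (n G) → Fin (n G) → Bool) → ℕ
countE G f = length (filter (λ e → T? (adj G (proj₁ e) (proj₂ e) ∧ f (proj₁ e) (proj₂ e)))
                            (pairs (n G)))

numEdges : Graph → ℕ
numEdges G = countE G (λ _ _ → true)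

record PerfectMatching (G : Graph) : Set where
  field
    M      : Fin (n G) → Fin (n G) → Bool
    symM   : ∀ u v → M u v ≡ M v u
    sub    : ∀ u v → T (M u v) → T (adj G u v)
    exact1 : ∀ v → countV (M v) ≡ 1
open PerfectMatching public

unionSize : (G : Graph) → PerfectMatching G → PerfectMatching G → PerfectMatching G → ℕ
unionSize G M₁ M₂ M₃ = countE G (λ u v → M M₁ u v ∨ M M₂ u v ∨ M M₃ u v)

data Reach (G : Graph) (P : Fin (n G) → Set) : Fin (n G) → Fin (n G) → Set where
  here : ∀ {u} → P u → Reach G P u u
  step : ∀ {u v w} → P u → T (adj G u v) → Reach G P v w → Reach G P u w

TwoConnected : Graph → Set
TwoConnected G =
  (3 Data.Nat.≤ n G)
  × (∀ u v → Reach G (λ _ → Data.Unit.⊤) u v)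
  × (∀ x u v → ¬ (u ≡ x) → ¬ (v ≡ x) → Reach G (λ w → ¬ (w ≡ x)) u v)
  where
    open import Relation.Nullary using (¬_)
    import Data.Unit

-- m₃(G) = p / q : some triple of perfect matchings covers exactly p/q of the
-- edges, and no triple covers more.
m3≡ : Graph → ℕ → ℕ → Set
m3≡ G p q =
  Data.Product.Σ (PerfectMatching G) (λ M₁ → Data.Product.Σ (PerfectMatching G) (λ M₂ →
    Data.Product.Σ (PerfectMatching G) (λ M₃ → unionSize G M₁ M₂ M₃ Data.Nat.* q ≡ p Data.Nat.* numEdges G)))
  × (∀ M₁ M₂ M₃ → unionSize G M₁ M₂ M₃ Data.Nat.* q Data.Nat.≤ p Data.Nat.* numEdges G)

{-# OPTIONS --safe #-}

-- Cut the edge 01 of the Petersen graph and of the Möbius ladder on 10 vertices, and join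
-- k such gadgets in a ring.  A perfect matching of the ring contains all of the linking
-- edges or none, so it restricts to a perfect matching of the closed-up gadget.  Any three
-- perfect matchings of the Petersen graph cover at most 12 of its 15 edges, while the
-- Möbius ladder is 3-edge-colourable.  Hence m₃ = (12a + 15(k − a)) / 15k when a of the
-- gadgets are Petersen, and k = qt, a = 5(q − p)t gives p/q for every t ≥ 1.
-- Edges are counted twice, as half-edges, so that the count splits into local sums over
-- the vertices of each gadget.
module Submission where

open import Defs
import Algebra.Properties.CommutativeMonoid.Sum as Sum
open import Data.Bool using (Bool; true; false; _∧_; _∨_; T; not; if_then_else_)
open import Data.Bool.Properties using (T?; T-≡; ∧-identityʳ) renaming (_≟_ to _≟ᵇ_)
open import Data.Empty using (⊥-elim)
open import Data.Fin using (Fin; zero; suc; toℕ; _≟_; combine; quotient; remainder; _↑ˡ_; _↑ʳ_; fromℕ; inject₁)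
open import Data.Fin.Induction using (<-weakInduction; >-weakInduction)
open import Data.Fin.Patterns
open import Data.Fin.Properties using (all?; toℕ-injective; toℕ-inject₁; combine-remQuot; remQuot-combine; combine-injectiveˡ; combine-injectiveʳ)
open import Data.Fin.Relation.Unary.Top using (View; ‵fromℕ; ‵inject₁; view; view-fromℕ; view-inject₁)
open import Data.List as List using (List; []; _∷_; filter; length; allFin; cartesianProduct)
import Data.List.Membership.DecPropositional as DecMembership
open import Data.List.Membership.Propositional using (_∈_)
open import Data.List.Properties using (filter-++; length-++)
open import Data.List.Relation.Unary.All as All using (All)
open import Data.Nat using (ℕ; zero; suc; _+_; _*_; _∸_; _≤_; _<_; _<ᵇ_; _≤?_; z≤n; s≤s)
open import Data.Nat.Properties hiding (_≟_; _≤?_)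
open import Data.Nat.Solver using (module +-*-Solver)
open import Data.Product using (Σ; ∃; _×_; _,_; proj₁; proj₂)
open import Data.Sum using (_⊎_; inj₁; inj₂; [_,_])
open import Data.Unit using (⊤; tt)
open import Data.Vec using (Vec; []; _∷_; lookup; tabulate; _++_; splitAt)
open import Data.Vec.Properties using (lookup∘tabulate; lookup-++ˡ; ≡-dec)
open import Function using (_∘_; id; Equivalence)
open import Relation.Binary.PropositionalEquality as ≡ using (_≡_; _≢_; _≗_; refl; trans; cong; cong₂; subst; subst₂; module ≡-Reasoning)
open import Relation.Nullary using (¬_; Dec; yes; no; does; contradiction)
open import Relation.Nullary.Decidable using (map′; _×-dec_; _→-dec_; ¬?; from-yes)

open Sum +-0-commutativeMonoid using (sum; sum-cong-≗; ∑-distrib-+; ∑-comm)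

-- Counting with sums

⟦_⟧ : Bool → ℕ
⟦ true ⟧  = 1
⟦ false ⟧ = 0

sum-mono-≤ : ∀ {n} {f g : Fin n → ℕ} → (∀ i → f i ≤ g i) → sum f ≤ sum g
sum-mono-≤ {zero}  f≤g = z≤n
sum-mono-≤ {suc n} f≤g = +-mono-≤ (f≤g zero) (sum-mono-≤ (f≤g ∘ suc))

sum-const : ∀ n c → sum {n} (λ _ → c) ≡ n * c
sum-const zero    c = refl
sum-const (suc n) c = cong (c +_) (sum-const n c)

sum-+ : ∀ m {n} (f : Fin (m + n) → ℕ) →
        sum f ≡ sum (λ i → f (i ↑ˡ n)) + sum (λ j → f (m ↑ʳ j))
sum-+ zero    f = refl
sum-+ (suc m) f = trans (cong (f zero +_) (sum-+ m (f ∘ suc))) (≡.sym (+-assoc (f zero) _ _))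

sum-combine : ∀ k m (f : Fin (k * m) → ℕ) → sum f ≡ sum (λ i → sum (λ x → f (combine {k} {m} i x)))
sum-combine zero    m f = refl
sum-combine (suc k) m f = trans (sum-+ m f) (cong (sum (λ x → f (x ↑ˡ (k * m))) +_) (sum-combine k m (f ∘ (m ↑ʳ_))))

sum-zero : ∀ n → sum {n} (λ _ → 0) ≡ 0
sum-zero n = trans (sum-const n 0) (*-zeroʳ n)

_==_ : ∀ {n} → Fin n → Fin n → Bool
i == j = does (i ≟ j)

==-refl : ∀ {n} (i : Fin n) → (i == i) ≡ true
==-refl zero    = refl
==-refl (suc i) = ==-refl i

==⇒≡ : ∀ {n} {i j : Fin n} → (i == j) ≡ true → i ≡ j
==⇒≡ {i = i} {j} eq with i ≟ j
... | yes i≡j = i≡j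

sum-delta : ∀ {n} (w : Fin n) (f : Fin n → Bool) → sum (λ v → ⟦ (w == v) ∧ f v ⟧) ≡ ⟦ f w ⟧
sum-delta {suc n} zero    f = trans (cong (⟦ f zero ⟧ +_) (sum-zero n)) (+-identityʳ _)
sum-delta {suc n} (suc w) f = sum-delta w (f ∘ suc)

count : ∀ {A : Set} → (A → Bool) → List A → ℕ
count f xs = length (filter (T? ∘ f) xs)

count-∷ : ∀ {A : Set} (f : A → Bool) x xs → count f (x ∷ xs) ≡ ⟦ f x ⟧ + count f xs
count-∷ f x xs with f x
... | true  = refl
... | false = refl

count-tabulate : ∀ {A : Set} {n} (f : A → Bool) (g : Fin n → A) →
                 count f (List.tabulate g) ≡ sum (λ i → ⟦ f (g i) ⟧)
count-tabulate {n = zero}  f g = refl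
count-tabulate {n = suc n} f g =
  trans (count-∷ f (g zero) _) (cong (⟦ f (g zero) ⟧ +_) (count-tabulate f (g ∘ suc)))

count-++ : ∀ {A : Set} (f : A → Bool) xs ys → count f (xs List.++ ys) ≡ count f xs + count f ys
count-++ f xs ys = trans (cong length (filter-++ (T? ∘ f) xs ys)) (length-++ (filter (T? ∘ f) xs))

count-map : ∀ {A B : Set} (f : B → Bool) (g : A → B) xs → count f (List.map g xs) ≡ count (f ∘ g) xs
count-map f g []       = refl
count-map f g (x ∷ xs) = trans (count-∷ f (g x) _)
  (trans (cong (_ +_) (count-map f g xs)) (≡.sym (count-∷ (f ∘ g) x xs)))

count-filter : ∀ {A : Set} (f g : A → Bool) xs →
               count f (filter (T? ∘ g) xs) ≡ count (λ x → g x ∧ f x) xs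
count-filter f g []       = refl
count-filter f g (x ∷ xs) with g x
... | false = count-filter f g xs
... | true  with f x
...   | true  = cong suc (count-filter f g xs)
...   | false = count-filter f g xs

count-cartesianProduct : ∀ {A B : Set} {m n} (f : A × B → Bool) (g : Fin m → A) (h : Fin n → B) →
  count f (cartesianProduct (List.tabulate g) (List.tabulate h)) ≡ sum (λ i → sum (λ j → ⟦ f (g i , h j) ⟧))
count-cartesianProduct {m = zero}  f g h = refl
count-cartesianProduct {m = suc m} f g h =
  trans (count-++ f (List.map (g zero ,_) (List.tabulate h)) _)
    (cong₂ _+_ (trans (count-map f (g zero ,_) (List.tabulate h)) (count-tabulate (λ y → f (g zero , y)) h))
               (count-cartesianProduct f (g ∘ suc) h))

countV≡sum : ∀ {k} (f : Fin k → Bool) → countV f ≡ sum (λ v → ⟦ f v ⟧)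
countV≡sum f = count-tabulate f id

countV-cong : ∀ {k} {f g : Fin k → Bool} → f ≗ g → countV f ≡ countV g
countV-cong {f = f} {g} f≗g =
  trans (countV≡sum f) (trans (sum-cong-≗ (cong ⟦_⟧ ∘ f≗g)) (≡.sym (countV≡sum g)))

countPairs : ∀ {k} (h : Fin k → Fin k → Bool) → ℕ
countPairs {k} h = count (λ e → h (proj₁ e) (proj₂ e)) (pairs k)

split-by-order : ∀ {k} (h : Fin k → Fin k → Bool) → (∀ v → h v v ≡ false) → ∀ u v →
  ⟦ h u v ⟧ ≡ ⟦ (toℕ u <ᵇ toℕ v) ∧ h u v ⟧ + ⟦ (toℕ v <ᵇ toℕ u) ∧ h u v ⟧
split-by-order h irr u v with toℕ u <ᵇ toℕ v in p | toℕ v <ᵇ toℕ u in q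
... | true  | false = ≡.sym (+-identityʳ _)
... | false | true  = refl
... | true  | true  = ⊥-elim (<-asym (<ᵇ⇒< (toℕ u) (toℕ v) (Equivalence.from T-≡ p))
                                     (<ᵇ⇒< (toℕ v) (toℕ u) (Equivalence.from T-≡ q)))
... | false | false = cong ⟦_⟧ (trans (cong (h u) (≡.sym u≡v)) (irr u))
  where
  u≡v : u ≡ v
  u≡v = toℕ-injective (≤-antisym
    (≮⇒≥ (λ v<u → subst T q (<⇒<ᵇ v<u))) (≮⇒≥ (λ u<v → subst T p (<⇒<ᵇ u<v))))

-- Exchanging the order of summation and using symmetry, the pairs with u below v are as many as
-- those with v below u; irreflexivity empties the diagonal.
double-countPairs : ∀ {k} (h : Fin k → Fin k → Bool) →
  (∀ u v → h u v ≡ h v u) → (∀ v → h v v ≡ false) →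
  2 * countPairs h ≡ sum (λ u → countV (h u))
double-countPairs {k} h h-sym irr = begin
  2 * countPairs h                                   ≡⟨ cong (2 *_) ordered ⟩
  X + (X + 0)                                        ≡⟨ cong (X +_) (+-identityʳ X) ⟩
  X + X                                              ≡⟨ cong (X +_) flip ⟩
  X + sum (λ u → sum (λ v → gt u v))                 ≡⟨ ∑-distrib-+ (λ u → sum (lt u)) (λ u → sum (gt u)) ⟨
  sum (λ u → sum (lt u) + sum (gt u))                ≡⟨ sum-cong-≗ (λ u → ≡.sym (∑-distrib-+ (lt u) (gt u))) ⟩
  sum (λ u → sum (λ v → lt u v + gt u v))            ≡⟨ sum-cong-≗ (λ u → sum-cong-≗ (λ v → ≡.sym (split-by-order h irr u v))) ⟩
  sum (λ u → sum (λ v → ⟦ h u v ⟧))                  ≡⟨ sum-cong-≗ (λ u → ≡.sym (countV≡sum (h u))) ⟩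
  sum (λ u → countV (h u))                           ∎
  where
  open ≡-Reasoning
  lt gt : Fin k → Fin k → ℕ
  lt u v = ⟦ (toℕ u <ᵇ toℕ v) ∧ h u v ⟧
  gt u v = ⟦ (toℕ v <ᵇ toℕ u) ∧ h u v ⟧
  X = sum (λ u → sum (lt u))
  ordered : countPairs h ≡ X
  ordered = trans (count-filter (λ e → h (proj₁ e) (proj₂ e)) (λ e → toℕ (proj₁ e) <ᵇ toℕ (proj₂ e))
                                (cartesianProduct (allFin k) (allFin k)))
                  (count-cartesianProduct {m = k} {k} _ id id)
  flip : X ≡ sum (λ u → sum (gt u))
  flip = trans (∑-comm lt)
    (sum-cong-≗ (λ v → sum-cong-≗ (λ u → cong (λ b → ⟦ (toℕ u <ᵇ toℕ v) ∧ b ⟧) (h-sym u v))))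

-- Cubic graphs given by a labelling of the three half-edges at each vertex

-- `nb-≢` and `nb-inj` exclude loops and parallel edges, so the resulting graph is simple and every
-- degree is 3; `nb-rev` gives the symmetry of adjacency.
record Rotation (N : ℕ) : Set where
  field
    nb     : Fin N → Fin 3 → Fin N
    rev    : Fin N → Fin 3 → Fin 3
    nb-rev : ∀ u c → nb (nb u c) (rev u c) ≡ u
    nb-≢   : ∀ u c → nb u c ≢ u
    nb-inj : ∀ u c c′ → nb u c ≡ nb u c′ → c ≡ c′

-- At most one disjunct is true, so the disjunction counts as a sum. The trailing zero is the form
-- to which a sum over `Fin 3` unfolds.
⟦∨∧⟧ : ∀ b₀ b₁ b₂ f → ¬ (b₀ ≡ true × b₁ ≡ true) → ¬ (b₀ ≡ true × b₂ ≡ true) → ¬ (b₁ ≡ true × b₂ ≡ true) →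
  ⟦ (b₀ ∨ b₁ ∨ b₂) ∧ f ⟧ ≡ ⟦ b₀ ∧ f ⟧ + (⟦ b₁ ∧ f ⟧ + (⟦ b₂ ∧ f ⟧ + 0))
⟦∨∧⟧ true  true  _     f p q r = contradiction (refl , refl) p
⟦∨∧⟧ true  false true  f p q r = contradiction (refl , refl) q
⟦∨∧⟧ true  false false f p q r = ≡.sym (+-identityʳ _)
⟦∨∧⟧ false true  true  f p q r = contradiction (refl , refl) r
⟦∨∧⟧ false true  false f p q r = ≡.sym (+-identityʳ _)
⟦∨∧⟧ false false true  f p q r = ≡.sym (+-identityʳ _)
⟦∨∧⟧ false false false f p q r = refl

∨-elim : ∀ b₀ b₁ b₂ → (b₀ ∨ b₁ ∨ b₂) ≡ true → b₀ ≡ true ⊎ b₁ ≡ true ⊎ b₂ ≡ true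
∨-elim true  _     _    _ = inj₁ refl
∨-elim false true  _    _ = inj₂ (inj₁ refl)
∨-elim false false true _ = inj₂ (inj₂ refl)

Bool-ext : ∀ {a b} → (a ≡ true → b ≡ true) → (b ≡ true → a ≡ true) → a ≡ b
Bool-ext {true}  {true}  f g = refl
Bool-ext {true}  {false} f g = ≡.sym (f refl)
Bool-ext {false} {true}  f g = g refl
Bool-ext {false} {false} f g = refl

one-of-three : (h : Fin 3 → Bool) → sum (λ c → ⟦ h c ⟧) ≡ 1 → Σ (Fin 3) λ c → ∀ c′ → h c′ ≡ (c == c′)
one-of-three h eq with h 0F in p | h 1F in q | h 2F in r
... | true  | false | false = 0F , λ { 0F → p ; 1F → q ; 2F → r }
... | false | true  | false = 1F , λ { 0F → p ; 1F → q ; 2F → r }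
... | false | false | true  = 2F , λ { 0F → p ; 1F → q ; 2F → r }

-- The number of distinct values among the three labels, that is, of half-edges at a vertex covered
-- by three matchings that use `c₁`, `c₂` and `c₃` there.
spread : Fin 3 → Fin 3 → Fin 3 → ℕ
spread c₁ c₂ c₃ = sum (λ c → ⟦ (c₁ == c) ∨ (c₂ == c) ∨ (c₃ == c) ⟧)

⟦⟧≤1 : ∀ b → ⟦ b ⟧ ≤ 1
⟦⟧≤1 true  = s≤s z≤n
⟦⟧≤1 false = z≤n

spread≤3 : ∀ c₁ c₂ c₃ → spread c₁ c₂ c₃ ≤ 3
spread≤3 c₁ c₂ c₃ = sum-mono-≤ {3} (λ c → ⟦⟧≤1 ((c₁ == c) ∨ (c₂ == c) ∨ (c₃ == c)))

module FromRotation {N : ℕ} (R : Rotation N) where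
  open Rotation R

  adjacent : Fin N → Fin N → Bool
  adjacent u v = (nb u 0F == v) ∨ (nb u 1F == v) ∨ (nb u 2F == v)

  adjacent-nb : ∀ u c → adjacent u (nb u c) ≡ true
  adjacent-nb u 0F rewrite ==-refl (nb u 0F) = refl
  adjacent-nb u 1F rewrite ==-refl (nb u 1F) with nb u 0F == nb u 1F
  ... | true  = refl
  ... | false = refl
  adjacent-nb u 2F rewrite ==-refl (nb u 2F) with nb u 0F == nb u 2F | nb u 1F == nb u 2F
  ... | true  | _     = refl
  ... | false | true  = refl
  ... | false | false = refl

  adjacent⇒nb : ∀ u v → adjacent u v ≡ true → ∃ λ c → nb u c ≡ v
  adjacent⇒nb u v eq with ∨-elim (nb u 0F == v) (nb u 1F == v) (nb u 2F == v) eq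
  ... | inj₁ p        = 0F , ==⇒≡ p
  ... | inj₂ (inj₁ p) = 1F , ==⇒≡ p
  ... | inj₂ (inj₂ p) = 2F , ==⇒≡ p

  adjacent-swap : ∀ u v → adjacent u v ≡ true → adjacent v u ≡ true
  adjacent-swap u v eq with adjacent⇒nb u v eq
  ... | c , refl = subst (λ w → adjacent (nb u c) w ≡ true) (nb-rev u c) (adjacent-nb (nb u c) (rev u c))

  graph : Graph
  graph = record
    { n     = N
    ; adj   = adjacent
    ; sym   = λ u v → Bool-ext (adjacent-swap u v) (adjacent-swap v u)
    ; irref = irr
    }
    where
    irr : ∀ v → adjacent v v ≡ false
    irr v with adjacent v v in eq
    ... | false = refl
    ... | true  with adjacent⇒nb v v eq
    ...   | c , nb≡v = contradiction nb≡v (nb-≢ v c)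

  -- By `nb-inj` each neighbour of u is met through a single half-edge, so a count over neighbours
  -- becomes a sum over labels.
  countV-adjacent : ∀ u (f : Fin N → Bool) →
    countV (λ v → adjacent u v ∧ f v) ≡ sum (λ c → ⟦ f (nb u c) ⟧)
  countV-adjacent u f = begin
    countV (λ v → adjacent u v ∧ f v)
      ≡⟨ countV≡sum (λ v → adjacent u v ∧ f v) ⟩
    sum (λ v → ⟦ adjacent u v ∧ f v ⟧)
      ≡⟨ sum-cong-≗ (λ v → ⟦∨∧⟧ (nb u 0F == v) (nb u 1F == v) (nb u 2F == v) (f v)
                             (excl 0F 1F (λ ()) v) (excl 0F 2F (λ ()) v) (excl 1F 2F (λ ()) v)) ⟩
    sum (λ v → sum (λ c → ⟦ (nb u c == v) ∧ f v ⟧))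
      ≡⟨ ∑-comm (λ v c → ⟦ (nb u c == v) ∧ f v ⟧) ⟩
    sum (λ c → sum (λ v → ⟦ (nb u c == v) ∧ f v ⟧))
      ≡⟨ sum-cong-≗ {3} (λ c → sum-delta (nb u c) f) ⟩
    sum (λ c → ⟦ f (nb u c) ⟧) ∎
    where
    open ≡-Reasoning
    excl : ∀ c c′ → c ≢ c′ → ∀ v → ¬ ((nb u c == v) ≡ true × (nb u c′ == v) ≡ true)
    excl c c′ c≢c′ v (p , q) = c≢c′ (nb-inj u c c′ (trans (==⇒≡ p) (≡.sym (==⇒≡ q))))

  cubic : Cubic graph
  cubic v = trans (countV-cong (λ w → ≡.sym (∧-identityʳ (adjacent v w)))) (countV-adjacent v (λ _ → true))

  double-countE : (f : Fin N → Fin N → Bool) → (∀ u v → f u v ≡ f v u) →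
    2 * countE graph f ≡ sum (λ u → sum (λ c → ⟦ f u (nb u c) ⟧))
  double-countE f f-sym = trans
    (double-countPairs (λ u v → adjacent u v ∧ f u v)
      (λ u v → cong₂ _∧_ (Graph.sym graph u v) (f-sym u v))
      (λ v → cong (_∧ f v v) (Graph.irref graph v)))
    (sum-cong-≗ (λ u → countV-adjacent u (f u)))

  double-numEdges : 2 * numEdges graph ≡ N * 3
  double-numEdges = trans (double-countE (λ _ _ → true) (λ _ _ → refl)) (sum-const N 3)

  -- Perfect matchings as choices of half-edges

  -- m u is thought of as the half-edge at u that lies in the matching.
  Compatible : (Fin N → Fin 3) → Set
  Compatible m = ∀ u → m (nb u (m u)) ≡ rev u (m u)

  module _ (𝓜 : PerfectMatching graph) where

    abstract
      selected : ∀ u → Σ (Fin 3) λ c → ∀ c′ → M 𝓜 u (nb u c′) ≡ (c == c′)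
      selected u = one-of-three (λ c → M 𝓜 u (nb u c))
        (trans (≡.sym (countV-adjacent u (M 𝓜 u))) (trans (countV-cong absorb) (exact1 𝓜 u)))
        where
        absorb : ∀ v → (adjacent u v ∧ M 𝓜 u v) ≡ M 𝓜 u v
        absorb v with M 𝓜 u v in eq
        ... | true  = cong (_∧ true) (Equivalence.to T-≡ (sub 𝓜 u v (Equivalence.from T-≡ eq)))
        ... | false with adjacent u v
        ...   | true  = refl
        ...   | false = refl

      label : Fin N → Fin 3
      label u = proj₁ (selected u)

      M-nb : ∀ u c → M 𝓜 u (nb u c) ≡ (label u == c)
      M-nb u = proj₂ (selected u)

    -- By symmetry of the matching, v uses its half-edge back to u, and by `M-nb` its label is the
    -- only half-edge that it uses.
    label-compatible : Compatible label
    label-compatible u = ==⇒≡ (begin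
      (label v == rev u (label u))           ≡⟨ M-nb v (rev u (label u)) ⟨
      M 𝓜 v (nb v (rev u (label u)))         ≡⟨ cong (M 𝓜 v) (nb-rev u (label u)) ⟩
      M 𝓜 v u                                ≡⟨ symM 𝓜 v u ⟩
      M 𝓜 u v                                ≡⟨ M-nb u (label u) ⟩
      (label u == label u)                   ≡⟨ ==-refl (label u) ⟩
      true                                   ∎)
      where
      open ≡-Reasoning
      v = nb u (label u)

  double-unionSize : ∀ 𝓜₁ 𝓜₂ 𝓜₃ →
    2 * unionSize graph 𝓜₁ 𝓜₂ 𝓜₃ ≡ sum (λ u → spread (label 𝓜₁ u) (label 𝓜₂ u) (label 𝓜₃ u))
  double-unionSize 𝓜₁ 𝓜₂ 𝓜₃ = trans
    (double-countE (λ u v → M 𝓜₁ u v ∨ M 𝓜₂ u v ∨ M 𝓜₃ u v)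
      (λ u v → cong₂ _∨_ (symM 𝓜₁ u v) (cong₂ _∨_ (symM 𝓜₂ u v) (symM 𝓜₃ u v))))
    (sum-cong-≗ (λ u → sum-cong-≗ {3} (λ c → cong ⟦_⟧
      (cong₂ _∨_ (M-nb 𝓜₁ u c) (cong₂ _∨_ (M-nb 𝓜₂ u c) (M-nb 𝓜₃ u c))))))

  module _ (m : Fin N → Fin 3) (m-compatible : Compatible m) where

    private
      -- The half-edge chosen at the mate is the reverse one, so following it leads back; the
      -- symmetry of the matching rests on this.
      mate-involutive : ∀ u → nb (nb u (m u)) (m (nb u (m u))) ≡ u
      mate-involutive u = trans (cong (nb (nb u (m u))) (m-compatible u)) (nb-rev u (m u))

      mate-swap : ∀ u v → (nb u (m u) == v) ≡ true → (nb v (m v) == u) ≡ true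
      mate-swap u v eq with ==⇒≡ {i = nb u (m u)} {v} eq
      ... | refl = subst (λ w → (nb (nb u (m u)) (m (nb u (m u))) == w) ≡ true)
                         (mate-involutive u) (==-refl (nb (nb u (m u)) (m (nb u (m u)))))

    matching : PerfectMatching graph
    matching = record
      { M      = λ u v → nb u (m u) == v
      ; symM   = λ u v → Bool-ext (mate-swap u v) (mate-swap v u)
      ; sub    = λ u v t → Equivalence.from T-≡ (subst (λ w → adjacent u w ≡ true)
                   (==⇒≡ (Equivalence.to T-≡ t)) (adjacent-nb u (m u)))
      ; exact1 = λ v → trans (countV-cong (λ w → ≡.sym (∧-identityʳ (nb v (m v) == w))))
                   (trans (countV≡sum (λ w → (nb v (m v) == w) ∧ true))
                          (sum-delta (nb v (m v)) (λ _ → true)))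
      }

    label-matching : ∀ u → label matching u ≡ m u
    label-matching u = ==⇒≡ (trans (≡.sym (M-nb matching u (m u))) (==-refl (nb u (m u))))

-- The gadgets

data Kind : Set where
  petersen ladder : Kind

-- Entry c of row x is (y , c′) when the half-edge c at x belongs to an edge xy that is
-- half-edge c′ at y.
table : Kind → Vec (Vec (Fin 10 × Fin 3) 3) 10
table petersen
  = ((1F , 0F) ∷ (4F , 1F) ∷ (5F , 0F) ∷ [])
  ∷ ((0F , 0F) ∷ (2F , 0F) ∷ (6F , 0F) ∷ [])
  ∷ ((1F , 1F) ∷ (3F , 0F) ∷ (7F , 0F) ∷ [])
  ∷ ((2F , 1F) ∷ (4F , 0F) ∷ (8F , 0F) ∷ [])
  ∷ ((3F , 1F) ∷ (0F , 1F) ∷ (9F , 0F) ∷ [])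
  ∷ ((0F , 2F) ∷ (7F , 1F) ∷ (8F , 2F) ∷ [])
  ∷ ((1F , 2F) ∷ (8F , 1F) ∷ (9F , 2F) ∷ [])
  ∷ ((2F , 2F) ∷ (5F , 1F) ∷ (9F , 1F) ∷ [])
  ∷ ((3F , 2F) ∷ (6F , 1F) ∷ (5F , 2F) ∷ [])
  ∷ ((4F , 2F) ∷ (7F , 2F) ∷ (6F , 2F) ∷ [])
  ∷ []
table ladder
  = ((1F , 0F) ∷ (9F , 1F) ∷ (5F , 2F) ∷ [])
  ∷ ((0F , 0F) ∷ (2F , 1F) ∷ (6F , 2F) ∷ [])
  ∷ ((3F , 0F) ∷ (1F , 1F) ∷ (7F , 2F) ∷ [])
  ∷ ((2F , 0F) ∷ (4F , 1F) ∷ (8F , 2F) ∷ [])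
  ∷ ((5F , 0F) ∷ (3F , 1F) ∷ (9F , 2F) ∷ [])
  ∷ ((4F , 0F) ∷ (6F , 1F) ∷ (0F , 2F) ∷ [])
  ∷ ((7F , 0F) ∷ (5F , 1F) ∷ (1F , 2F) ∷ [])
  ∷ ((6F , 0F) ∷ (8F , 1F) ∷ (2F , 2F) ∷ [])
  ∷ ((9F , 0F) ∷ (7F , 1F) ∷ (3F , 2F) ∷ [])
  ∷ ((8F , 0F) ∷ (0F , 1F) ∷ (4F , 2F) ∷ [])
  ∷ []

nbr : Kind → Fin 10 → Fin 3 → Fin 10
nbr τ x c = proj₁ (lookup (lookup (table τ) x) c)

rv : Kind → Fin 10 → Fin 3 → Fin 3
rv τ x c = proj₂ (lookup (lookup (table τ) x) c)

-- The edge 01 of every gadget is cut open: its half at 0 leads to the previous gadget of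
-- the ring and its half at 1 to the next one.
data Port : Set where
  left right inner : Port

port : Fin 10 → Fin 3 → Port
port 0F 0F = left
port 1F 0F = right
port _  _  = inner

opposite : Port → Port
opposite left  = right
opposite right = left
opposite inner = inner

_≟ᴾ_ : (d e : Port) → Dec (d ≡ e)
left  ≟ᴾ left  = yes refl
left  ≟ᴾ right = no λ ()
left  ≟ᴾ inner = no λ ()
right ≟ᴾ left  = no λ ()
right ≟ᴾ right = yes refl
right ≟ᴾ inner = no λ ()
inner ≟ᴾ left  = no λ ()
inner ≟ᴾ right = no λ ()
inner ≟ᴾ inner = yes refl

-- The kind of the gadget entered through a port, when τ is the current kind and τ′ the
-- kind of the neighbouring gadget.
across : Port → Kind → Kind → Kind
across inner τ τ′ = τ
across _     τ τ′ = τ′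

-- Finite checks on the tables

nbr-left : ∀ τ → nbr τ 0F 0F ≡ 1F
nbr-left petersen = refl
nbr-left ladder   = refl

nbr-right : ∀ τ → nbr τ 1F 0F ≡ 0F
nbr-right petersen = refl
nbr-right ladder   = refl

all-kinds? : {P : Kind → Set} → (∀ τ → Dec (P τ)) → Dec (∀ τ → P τ)
all-kinds? P? = map′ (λ { (p , l) petersen → p ; (p , l) ladder → l }) (λ f → f petersen , f ladder)
                     (P? petersen ×-dec P? ladder)

port-opposite : ∀ τ x c → port (nbr τ x c) (rv τ x c) ≡ opposite (port x c)
port-opposite = from-yes (all-kinds? λ τ → all? λ x → all? λ c → port (nbr τ x c) (rv τ x c) ≟ᴾ opposite (port x c))

-- Gadgets of different kinds can be linked because in both tables the edge 01 is half-edge 0 at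
-- each of its ends.
nbr-rv : ∀ τ τ′ x c → nbr (across (port x c) τ τ′) (nbr τ x c) (rv τ x c) ≡ x
nbr-rv = from-yes (all-kinds? λ τ → all-kinds? λ τ′ → all? λ x → all? λ c →
  nbr (across (port x c) τ τ′) (nbr τ x c) (rv τ x c) ≟ x)

nbr-≢ : ∀ τ x c → nbr τ x c ≢ x
nbr-≢ = from-yes (all-kinds? λ τ → all? λ x → all? λ c → ¬? (nbr τ x c ≟ x))

nbr-inj : ∀ τ x c c′ → nbr τ x c ≡ nbr τ x c′ → c ≡ c′
nbr-inj = from-yes (all-kinds? λ τ → all? λ x → all? λ c → all? λ c′ →
  (nbr τ x c ≟ nbr τ x c′) →-dec (c ≟ c′))

-- In both kinds matching 0 contains the cut edge and matchings 1 and 2 avoid it, so equal indices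
-- fit together across every link, also between different kinds.
chosen : Kind → Fin 3 → Fin 10 → Fin 3
chosen petersen 0F = lookup (0F ∷ 0F ∷ 1F ∷ 0F ∷ 2F ∷ 1F ∷ 1F ∷ 1F ∷ 1F ∷ 0F ∷ [])
chosen petersen 1F = lookup (1F ∷ 1F ∷ 0F ∷ 2F ∷ 1F ∷ 1F ∷ 2F ∷ 1F ∷ 0F ∷ 2F ∷ [])
chosen petersen 2F = lookup (2F ∷ 1F ∷ 0F ∷ 1F ∷ 0F ∷ 0F ∷ 1F ∷ 2F ∷ 1F ∷ 1F ∷ [])
-- In the ladder table both halves of an edge carry the same label, so the labels are a
-- 3-edge-colouring and this is colour class j.
chosen ladder   j  = λ _ → j

chosen-compatible : ∀ τ τ′ j x → let c = chosen τ j x in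
  chosen (across (port x c) τ τ′) j (nbr τ x c) ≡ rv τ x c
chosen-compatible = from-yes (all-kinds? λ τ → all-kinds? λ τ′ → all? λ j → all? λ x →
  let c = chosen τ j x in chosen (across (port x c) τ τ′) j (nbr τ x c) ≟ rv τ x c)

-- Twice the number of covered edges; an edge between gadgets contributes one half to each.
capacity : Kind → ℕ
capacity petersen = 24
capacity ladder   = 30

chosen-spread : ∀ τ → sum (λ x → spread (chosen τ 0F x) (chosen τ 1F x) (chosen τ 2F x)) ≡ capacity τ
chosen-spread petersen = refl
chosen-spread ladder   = refl

-- Compatibility along the uncut edges only: at a port the partner lies in a neighbouring gadget.
Local : Kind → (Fin 10 → Fin 3) → Set
Local τ g = ∀ x → port x (g x) ≡ inner → g (nbr τ x (g x)) ≡ rv τ x (g x)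

-- The six perfect matchings of the Petersen graph; the first two contain the edge 01, and the last
-- consists of the spokes.
petersenMatchings : List (Vec (Fin 3) 10)
petersenMatchings
  = (0F ∷ 0F ∷ 1F ∷ 0F ∷ 2F ∷ 1F ∷ 1F ∷ 1F ∷ 1F ∷ 0F ∷ [])
  ∷ (0F ∷ 0F ∷ 2F ∷ 1F ∷ 0F ∷ 2F ∷ 2F ∷ 0F ∷ 2F ∷ 2F ∷ [])
  ∷ (1F ∷ 1F ∷ 0F ∷ 2F ∷ 1F ∷ 1F ∷ 2F ∷ 1F ∷ 0F ∷ 2F ∷ [])
  ∷ (1F ∷ 2F ∷ 1F ∷ 0F ∷ 1F ∷ 2F ∷ 0F ∷ 2F ∷ 2F ∷ 1F ∷ [])
  ∷ (2F ∷ 1F ∷ 0F ∷ 1F ∷ 0F ∷ 0F ∷ 1F ∷ 2F ∷ 1F ∷ 1F ∷ [])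
  ∷ (2F ∷ 2F ∷ 2F ∷ 2F ∷ 2F ∷ 0F ∷ 0F ∷ 0F ∷ 0F ∷ 0F ∷ [])
  ∷ []

all-vectors? : ∀ n {P : Vec (Fin 3) n → Set} → (∀ v → Dec (P v)) → Dec (∀ v → P v)
all-vectors? zero    P? = map′ (λ { p [] → p }) (λ f → f []) (P? [])
all-vectors? (suc n) P? = map′ (λ { f (c ∷ v) → f c v }) (λ f c v → f (c ∷ v))
                               (all? λ c → all-vectors? n (λ v → P? (c ∷ v)))

local? : ∀ v → Dec (Local petersen (lookup v))
local? v = all? λ x → (port x (lookup v x) ≟ᴾ inner) →-dec
  (lookup v (nbr petersen x (lookup v x)) ≟ rv petersen x (lookup v x))

open DecMembership (≡-dec {n = 10} (_≟_ {3})) using (_∈?_)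

-- The constraints on the path 12340 alone; testing them first prunes the exhaustive search.
Outer : Vec (Fin 3) 5 → Set
Outer u = ∀ x y → let c = lookup u x in
  port (x ↑ˡ 5) c ≡ inner → y ↑ˡ 5 ≡ nbr petersen (x ↑ˡ 5) c → lookup u y ≡ rv petersen (x ↑ˡ 5) c

outer? : ∀ u → Dec (Outer u)
outer? u = all? λ x → all? λ y → let c = lookup u x in
  (port (x ↑ˡ 5) c ≟ᴾ inner) →-dec ((y ↑ˡ 5 ≟ nbr petersen (x ↑ˡ 5) c) →-dec (lookup u y ≟ rv petersen (x ↑ˡ 5) c))

local⇒outer : ∀ u (w : Vec (Fin 3) 5) → Local petersen (lookup (u ++ w)) → Outer u
local⇒outer u w local x y inner-port y≡ with local (x ↑ˡ 5)
... | at-x rewrite lookup-++ˡ u w x = begin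
  lookup u y                                              ≡⟨ lookup-++ˡ u w y ⟨
  lookup (u ++ w) (y ↑ˡ 5)                                ≡⟨ cong (lookup (u ++ w)) y≡ ⟩
  lookup (u ++ w) (nbr petersen (x ↑ˡ 5) (lookup u x))    ≡⟨ at-x inner-port ⟩
  rv petersen (x ↑ˡ 5) (lookup u x)                       ∎
  where open ≡-Reasoning

abstract
  -- This exhaustive check subsumes the parity argument: the cut edge is used at both ends or
  -- at neither.
  outer-local⇒∈ : ∀ u → Outer u → ∀ w → Local petersen (lookup (u ++ w)) → (u ++ w) ∈ petersenMatchings
  outer-local⇒∈ = from-yes (all-vectors? 5 λ u → outer? u →-dec (all-vectors? 5 λ w →
    local? (u ++ w) →-dec (u ++ w ∈? petersenMatchings)))

local⇒∈ : ∀ v → Local petersen (lookup v) → v ∈ petersenMatchings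
local⇒∈ v local with splitAt 5 v
... | u , w , refl = outer-local⇒∈ u (local⇒outer u w local) w local

-- Two distinct perfect matchings of the Petersen graph share exactly one edge and no edge lies in
-- three of them. Three distinct ones thus cover 15 - 3 = 12 edges, which is 24 half-edges;
-- repetitions cover fewer.
petersenMatchings-spread :
  All (λ u → All (λ v → All (λ w → sum (λ x → spread (lookup u x) (lookup v x) (lookup w x)) ≤ 24)
    petersenMatchings) petersenMatchings) petersenMatchings
petersenMatchings-spread = from-yes
  (All.all? (λ u → All.all? (λ v → All.all? (λ w →
    sum (λ x → spread (lookup u x) (lookup v x) (lookup w x)) ≤? 24)
      petersenMatchings) petersenMatchings) petersenMatchings)

local⇒tabulate∈ : ∀ g → Local petersen g → tabulate g ∈ petersenMatchings
local⇒tabulate∈ g g-local = local⇒∈ (tabulate g) local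
  where
  local : Local petersen (lookup (tabulate g))
  local x rewrite lookup∘tabulate g x | lookup∘tabulate g (nbr petersen x (g x)) = g-local x

local-spread : ∀ τ g₁ g₂ g₃ → Local τ g₁ → Local τ g₂ → Local τ g₃ →
  sum (λ x → spread (g₁ x) (g₂ x) (g₃ x)) ≤ capacity τ
-- Ten vertices with three half-edges each already give the bound 30.
local-spread ladder g₁ g₂ g₃ _ _ _ = sum-mono-≤ {10} (λ x → spread≤3 (g₁ x) (g₂ x) (g₃ x))
local-spread petersen g₁ g₂ g₃ l₁ l₂ l₃ = subst (_≤ 24)
  (sum-cong-≗ {10} (λ x → trans
    (cong₂ (λ a b → spread a b (lookup (tabulate g₃) x)) (lookup∘tabulate g₁ x) (lookup∘tabulate g₂ x))
    (cong (spread (g₁ x) (g₂ x)) (lookup∘tabulate g₃ x))))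
  (All.lookup (All.lookup (All.lookup petersenMatchings-spread
    (local⇒tabulate∈ g₁ l₁)) (local⇒tabulate∈ g₂ l₂)) (local⇒tabulate∈ g₃ l₃))

-- Connectivity of a gadget with its edge 01 cut

isInner : Port → Bool
isInner inner = true
isInner _     = false

-- Looks for a walk of at most f uncut edges inside ok, from x to goal.
search : Kind → (ok goal : Fin 10 → Bool) → ℕ → Fin 10 → Bool
search τ ok goal zero    x = ok x ∧ goal x
search τ ok goal (suc f) x = ok x ∧ (goal x ∨ (via 0F ∨ via 1F ∨ via 2F))
  where
  via : Fin 3 → Bool
  via c = isInner (port x c) ∧ search τ ok goal f (nbr τ x c)

abstract
  -- Kept abstract: unfolding search τ ok goal 4 x at a variable x is very expensive.
  radius : ℕ
  radius = 4

  search-connected : ∀ τ x → search τ (λ _ → true) (_== 0F) radius x ≡ true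
  search-connected = from-yes (all-kinds? λ τ → all? λ x → search τ (λ _ → true) (_== 0F) radius x ≟ᵇ true)

  -- Deleting one vertex of a gadget seals no other vertex off from both ports; the ring then
  -- supplies the way round.
  search-avoiding : ∀ τ z x → x ≢ z → search τ (λ y → not (y == z)) (λ y → (y == 0F) ∨ (y == 1F)) radius x ≡ true
  search-avoiding = from-yes (all-kinds? λ τ → all? λ z → all? λ x →
    ¬? (x ≟ z) →-dec (search τ (λ y → not (y == z)) (λ y → (y == 0F) ∨ (y == 1F)) radius x ≟ᵇ true))

-- Cyclic order on Fin

prev : ∀ {n} → Fin (suc n) → Fin (suc n)
prev zero    = fromℕ _
prev (suc i) = inject₁ i

next : ∀ {n} → Fin (suc n) → Fin (suc n)
next i = go (view i)
  where
  go : ∀ {n} {i : Fin (suc n)} → View i → Fin (suc n)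
  go ‵fromℕ       = zero
  go (‵inject₁ j) = suc j

next-fromℕ : ∀ n → next (fromℕ n) ≡ zero
next-fromℕ n rewrite view-fromℕ n = refl

next-inject₁ : ∀ {n} (i : Fin n) → next (inject₁ i) ≡ suc i
next-inject₁ i rewrite view-inject₁ i = refl

prev-next : ∀ {n} (i : Fin (suc n)) → prev (next i) ≡ i
prev-next i with view i
... | ‵fromℕ     = refl
... | ‵inject₁ j = refl

next-prev : ∀ {n} (i : Fin (suc n)) → next (prev i) ≡ i
next-prev zero    = next-fromℕ _
next-prev (suc i) = next-inject₁ i

-- On a single index `next` is the identity, hence the two indices required here and the `2 + k′`
-- gadgets of a ring.
next-≢ : ∀ {n} (i : Fin (2 + n)) → next i ≢ i
next-≢ i eq with view i
... | ‵fromℕ     with () ← eq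
... | ‵inject₁ j = 1+n≢n (trans (cong toℕ eq) (toℕ-inject₁ j))

cyclic-induction : ∀ {n} (P : Fin (suc n) → Set) → (∀ i → P i → P (next i)) → ∀ {i} → P i → ∀ j → P j
-- Climb from i to the last index, wrap round to zero, and climb again through all indices. The
-- first climb is a downward induction on the implication from `P j` to `P (fromℕ n)`.
cyclic-induction {n} P P-next {i} Pi = <-weakInduction P
  (subst P (next-fromℕ n) (P-next _ (>-weakInduction (λ j → P j → P (fromℕ n)) (λ p → p)
    (λ j up p → up (ascend j p)) i Pi)))
  ascend
  where
  ascend : ∀ j → P (inject₁ j) → P (suc j)
  ascend j = subst P (next-inject₁ j) ∘ P-next (inject₁ j)

-- Reachability

module _ {G : Graph} {P : Fin (n G) → Set} where

  reach-trans : ∀ {u v w} → Reach G P u v → Reach G P v w → Reach G P u w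
  reach-trans (here _)     r = r
  reach-trans (step p e q) r = step p e (reach-trans q r)

  reach-start : ∀ {u v} → Reach G P u v → P u
  reach-start (here p)     = p
  reach-start (step p _ _) = p

  reach-sym : ∀ {u v} → Reach G P u v → Reach G P v u
  reach-sym (here p)             = here p
  reach-sym (step {u} {v} p e r) = reach-trans (reach-sym r)
    (step (reach-start r) (subst T (Graph.sym G u v) e) (here p))

reach-map : ∀ {G} {P Q : Fin (n G) → Set} → (∀ {v} → P v → Q v) → ∀ {u v} → Reach G P u v → Reach G Q u v
reach-map f (here p)     = here (f p)
reach-map f (step p e r) = step (f p) e (reach-map f r)

avoid-two : ∀ {N} → 3 ≤ N → (u v : Fin N) → Σ (Fin N) λ x → u ≢ x × v ≢ x
avoid-two (s≤s (s≤s (s≤s _))) zero          zero          = 1F , (λ ()) , λ ()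
avoid-two (s≤s (s≤s (s≤s _))) zero          (suc zero)    = 2F , (λ ()) , λ ()
avoid-two (s≤s (s≤s (s≤s _))) zero          (suc (suc _)) = 1F , (λ ()) , λ ()
avoid-two (s≤s (s≤s (s≤s _))) (suc zero)    zero          = 2F , (λ ()) , λ ()
avoid-two (s≤s (s≤s (s≤s _))) (suc (suc _)) zero          = 1F , (λ ()) , λ ()
avoid-two (s≤s (s≤s (s≤s _))) (suc _)       (suc _)       = 0F , (λ ()) , λ ()

-- Plain connectivity follows by deleting a third vertex, different from both ends.
twoConnected : ∀ G → 3 ≤ n G → (∀ x u v → u ≢ x → v ≢ x → Reach G (_≢ x) u v) → TwoConnected G
twoConnected G 3≤n conn = 3≤n , connected , conn
  where
  connected : ∀ u v → Reach G (λ _ → ⊤) u v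
  connected u v with avoid-two 3≤n u v
  ... | x , u≢x , v≢x = reach-map (λ _ → tt) (conn x u v u≢x v≢x)

-- Rings of gadgets

module Ring {k′ : ℕ} (kind : Fin (2 + k′) → Kind) where

  k : ℕ
  k = 2 + k′

  move : Port → Fin k → Fin k
  move left  = prev
  move right = next
  move inner = λ i → i

  move-opposite : ∀ d i → move (opposite d) (move d i) ≡ i
  move-opposite left  = next-prev
  move-opposite right = prev-next
  move-opposite inner = λ _ → refl

  kind-move : ∀ d i → kind (move d i) ≡ across d (kind i) (kind (move d i))
  kind-move left  i = refl
  kind-move right i = refl
  kind-move inner i = refl

  vertex : Fin k → Fin 10 → Fin (k * 10)
  vertex = combine

  gadget : Fin (k * 10) → Fin k
  gadget = quotient 10

  place : Fin (k * 10) → Fin 10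
  place = remainder {k} 10

  gadget-vertex : ∀ i x → gadget (vertex i x) ≡ i
  gadget-vertex i x = cong proj₁ (remQuot-combine {k} {10} i x)

  place-vertex : ∀ i x → place (vertex i x) ≡ x
  place-vertex i x = cong proj₂ (remQuot-combine {k} {10} i x)

  on-vertices : (P : Fin (k * 10) → Set) → (∀ i x → P (vertex i x)) → ∀ v → P v
  on-vertices P p v = subst P (combine-remQuot {k} 10 v) (p (gadget v) (place v))

  -- A link reuses the table entry of the cut edge: from 0 it still leads to a vertex 1, but that of
  -- the previous gadget, and from 1 to the vertex 0 of the next.
  nb : Fin (k * 10) → Fin 3 → Fin (k * 10)
  nb v c = vertex (move (port (place v) c) (gadget v)) (nbr (kind (gadget v)) (place v) c)

  rev : Fin (k * 10) → Fin 3 → Fin 3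
  rev v c = rv (kind (gadget v)) (place v) c

  nb-vertex : ∀ i x c → nb (vertex i x) c ≡ vertex (move (port x c) i) (nbr (kind i) x c)
  nb-vertex i x c rewrite gadget-vertex i x | place-vertex i x = refl

  rev-vertex : ∀ i x c → rev (vertex i x) c ≡ rv (kind i) x c
  rev-vertex i x c rewrite gadget-vertex i x | place-vertex i x = refl

  place-nb : ∀ v c → place (nb v c) ≡ nbr (kind (gadget v)) (place v) c
  place-nb v c = place-vertex (move (port (place v) c) (gadget v)) (nbr (kind (gadget v)) (place v) c)

  nb-rev : ∀ v c → nb (nb v c) (rev v c) ≡ v
  nb-rev v c = on-vertices (λ v → nb (nb v c) (rev v c) ≡ v) (λ i x → begin
    nb (nb (vertex i x) c) (rev (vertex i x) c)
      ≡⟨ cong₂ nb (nb-vertex i x c) (rev-vertex i x c) ⟩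
    nb (vertex (move (port x c) i) (nbr (kind i) x c)) (rv (kind i) x c)
      ≡⟨ nb-vertex (move (port x c) i) (nbr (kind i) x c) (rv (kind i) x c) ⟩
    vertex (move (port (nbr (kind i) x c) (rv (kind i) x c)) (move (port x c) i))
           (nbr (kind (move (port x c) i)) (nbr (kind i) x c) (rv (kind i) x c))
      ≡⟨ cong₂ vertex
           (trans (cong (λ d → move d (move (port x c) i)) (port-opposite (kind i) x c))
                  (move-opposite (port x c) i))
           (trans (cong (λ τ → nbr τ (nbr (kind i) x c) (rv (kind i) x c)) (kind-move (port x c) i))
                  (nbr-rv (kind i) (kind (move (port x c) i)) x c)) ⟩
    vertex i x ∎) v
    where open ≡-Reasoning

  rotation : Rotation (k * 10)
  rotation = record
    { nb     = nb
    ; rev    = rev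
    ; nb-rev = nb-rev
    -- Loops and parallel edges are excluded by the places alone, so links need no separate
    -- treatment.
    ; nb-≢   = λ v c eq → nbr-≢ (kind (gadget v)) (place v) c (trans (≡.sym (place-nb v c)) (cong place eq))
    ; nb-inj = λ v c c′ eq → nbr-inj (kind (gadget v)) (place v) c c′
                 (trans (≡.sym (place-nb v c)) (trans (cong place eq) (place-nb v c′)))
    }

  open FromRotation rotation

  compatible⇒local : ∀ m → Compatible m → ∀ i → Local (kind i) (λ x → m (vertex i x))
  compatible⇒local m m-compatible i x port≡inner = begin
    m (vertex i (nbr (kind i) x c))
      ≡⟨ cong (λ d → m (vertex (move d i) (nbr (kind i) x c))) port≡inner ⟨
    m (vertex (move (port x c) i) (nbr (kind i) x c))
      ≡⟨ cong m (nb-vertex i x c) ⟨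
    m (nb (vertex i x) c)
      ≡⟨ m-compatible (vertex i x) ⟩
    rev (vertex i x) c
      ≡⟨ rev-vertex i x c ⟩
    rv (kind i) x c ∎
    where
    open ≡-Reasoning
    c = m (vertex i x)

  -- Edges covered by three perfect matchings of a ring

  total : ℕ
  total = sum (λ i → capacity (kind i))

  union≤total : ∀ 𝓜₁ 𝓜₂ 𝓜₃ → 2 * unionSize graph 𝓜₁ 𝓜₂ 𝓜₃ ≤ total
  union≤total 𝓜₁ 𝓜₂ 𝓜₃ = ≤-trans
    (≤-reflexive (trans (double-unionSize 𝓜₁ 𝓜₂ 𝓜₃) (sum-combine k 10 covered)))
    (sum-mono-≤ {k} {λ i → sum (λ x → covered (vertex i x))} {λ i → capacity (kind i)}
      (λ i → local-spread (kind i) _ _ _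
               (local 𝓜₁ i) (local 𝓜₂ i) (local 𝓜₃ i)))
    where
    covered : Fin (k * 10) → ℕ
    covered v = spread (label 𝓜₁ v) (label 𝓜₂ v) (label 𝓜₃ v)

    local : (𝓜 : PerfectMatching graph) (i : Fin k) → Local (kind i) (λ x → label 𝓜 (vertex i x))
    local 𝓜 = compatible⇒local (label 𝓜) (label-compatible 𝓜)

  choice : Fin 3 → Fin (k * 10) → Fin 3
  choice j v = chosen (kind (gadget v)) j (place v)

  choice-vertex : ∀ j i x → choice j (vertex i x) ≡ chosen (kind i) j x
  choice-vertex j i x rewrite gadget-vertex i x | place-vertex i x = refl

  choice-compatible : ∀ j → Compatible (choice j)
  choice-compatible j v = trans (choice-vertex j _ _)
    (trans (cong (λ τ → chosen τ j (nbr (kind i) x c)) (kind-move (port x c) i))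
           (chosen-compatible (kind i) (kind (move (port x c) i)) j x))
    where
    i = gadget v
    x = place v
    c = choice j v

  best : Fin 3 → PerfectMatching graph
  best j = matching (choice j) (choice-compatible j)

  union≡total : 2 * unionSize graph (best 0F) (best 1F) (best 2F) ≡ total
  union≡total = trans (double-unionSize (best 0F) (best 1F) (best 2F))
    (trans (sum-combine k 10 (λ v → spread (label (best 0F) v) (label (best 1F) v) (label (best 2F) v)))
      (sum-cong-≗ {k} (λ i → trans (sum-cong-≗ {10} (λ x → trans
        (cong₂ (λ a b → spread a b (label (best 2F) (vertex i x))) (label-best 0F i x) (label-best 1F i x))
        (cong (spread (chosen (kind i) 0F x) (chosen (kind i) 1F x)) (label-best 2F i x))))
        (chosen-spread (kind i)))))
    where
    label-best : ∀ j i x → label (best j) (vertex i x) ≡ chosen (kind i) j x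
    label-best j i x = trans (label-matching (choice j) (choice-compatible j) (vertex i x)) (choice-vertex j i x)

  -- Two-connectedness of a ring

  edge : ∀ i x c → T (adjacent (vertex i x) (vertex (move (port x c) i) (nbr (kind i) x c)))
  edge i x c = Equivalence.from T-≡
    (subst (λ w → adjacent (vertex i x) w ≡ true) (nb-vertex i x c) (adjacent-nb (vertex i x) c))

  -- The search follows inner half-edges only, so its walk lifts to gadget i of the ring without
  -- leaving it.
  search-sound : ∀ {P : Fin (k * 10) → Set} {ok goal} i → (∀ x → ok x ≡ true → P (vertex i x)) → ∀ f x →
    search (kind i) ok goal f x ≡ true → Σ (Fin 10) λ z → goal z ≡ true × Reach graph P (vertex i x) (vertex i z)
  search-sound {ok = ok} {goal} i okP zero x eq with ok x in o | goal x in g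
  ... | true | true = x , g , here (okP x o)
  search-sound {P} {ok} {goal} i okP (suc f) x eq with ok x in o | goal x in g
  ... | true | true  = x , g , here (okP x o)
  ... | true | false = [ along 0F , [ along 1F , along 2F ] ] (∨-elim _ _ _ eq)
    where
    along : ∀ c → (isInner (port x c) ∧ search (kind i) ok goal f (nbr (kind i) x c)) ≡ true →
            Σ (Fin 10) λ z → goal z ≡ true × Reach graph P (vertex i x) (vertex i z)
    -- Abstracting the port together with the edge lets `move inner i` reduce to i in the type of
    -- the edge.
    along c e with port x c | edge i x c
    ... | inner | x~y with search-sound i okP f (nbr (kind i) x c) e
    ...   | z , gz , r = z , gz , step (okP x o) x~y r

  module Avoiding (i₀ : Fin k) (x₀ : Fin 10) where

    Avoid : Fin (k * 10) → Set
    Avoid = _≢ vertex i₀ x₀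

    base : Fin (k * 10)
    base = vertex (next i₀) 0F

    -- Going once around the ring from base, the gadget of the deleted vertex comes last, and
    -- it can be left through either of its ports.
    Reached : Fin k → Set
    Reached i = ∀ x → Avoid (vertex i x) → Reach graph Avoid (vertex i x) base

    outside : ∀ {i} → i ≢ i₀ → ∀ x → Avoid (vertex i x)
    outside {i} i≢i₀ x eq = i≢i₀ (combine-injectiveˡ {k} {10} i x i₀ x₀ eq)

    to-entrance : ∀ {i} → i ≢ i₀ → ∀ x → Reach graph Avoid (vertex i x) (vertex i 0F)
    to-entrance {i} i≢i₀ x with search-sound {Avoid} i (λ y _ → outside i≢i₀ y) radius x (search-connected (kind i) x)
    ... | z , z≡0 , r = subst (λ z → Reach graph Avoid (vertex i x) (vertex i z)) (==⇒≡ z≡0) r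

    entrance-edge : ∀ i → T (adjacent (vertex (next i) 0F) (vertex i 1F))
    entrance-edge i = subst₂ (λ j y → T (adjacent (vertex (next i) 0F) (vertex j y)))
      (prev-next i) (nbr-left (kind (next i))) (edge (next i) 0F 0F)

    exit-edge : ∀ i → T (adjacent (vertex i 1F) (vertex (next i) 0F))
    exit-edge i = subst (λ y → T (adjacent (vertex i 1F) (vertex (next i) y)))
      (nbr-right (kind i)) (edge i 1F 0F)

    reached-first : Reached (next i₀)
    reached-first x _ = to-entrance (next-≢ i₀) x

    reached-last : ∀ {i} → i ≢ i₀ → next i ≡ i₀ → Reached i → Reached i₀
    reached-last {i} i≢i₀ next≡ reached x x∈ = leave (search-sound i₀ ok⇒avoid radius x
      (search-avoiding (kind i₀) x₀ x (λ x≡x₀ → x∈ (cong (vertex i₀) x≡x₀))))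
      where
      ok⇒avoid : ∀ y → not (y == x₀) ≡ true → Avoid (vertex i₀ y)
      ok⇒avoid y ok eq with combine-injectiveʳ {k} {10} i₀ y i₀ x₀ eq
      ... | refl rewrite ==-refl y = contradiction ok (λ ())

      leave : (Σ (Fin 10) λ z → ((z == 0F) ∨ (z == 1F)) ≡ true × Reach graph Avoid (vertex i₀ x) (vertex i₀ z)) →
              Reach graph Avoid (vertex i₀ x) base
      -- Through vertex 0 the walk enters the preceding gadget, which is already joined to `base`.
      leave (0F , _ , r) = reach-trans r (step (reach-start (reach-sym r))
        (subst (λ j → T (adjacent (vertex j 0F) (vertex i 1F))) next≡ (entrance-edge i))
        (reached 1F (outside i≢i₀ 1F)))
      -- Through vertex 1 the next vertex is `base` itself.
      leave (1F , _ , r) = reach-trans r (step (reach-start (reach-sym r)) (exit-edge i₀)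
        (here (outside (next-≢ i₀) 0F)))

    -- After `i₀` the induction restarts in the gadget of `base`. Every other intact gadget is
    -- joined through its vertex 0 to vertex 1 of its predecessor.
    reached-next : ∀ i → Reached i → Reached (next i)
    reached-next i reached with i ≟ i₀ | next i ≟ i₀
    ... | yes refl | _         = reached-first
    ... | no i≢i₀  | yes next≡ = subst Reached (≡.sym next≡) (reached-last i≢i₀ next≡ reached)
    ... | no i≢i₀  | no next≢  = λ x _ → reach-trans (to-entrance next≢ x)
      (step (outside next≢ 0F) (entrance-edge i) (reached 1F (outside i≢i₀ 1F)))

    reached-all : ∀ v → Avoid v → Reach graph Avoid v base
    reached-all = on-vertices (λ v → Avoid v → Reach graph Avoid v base)
      (cyclic-induction Reached reached-next {next i₀} reached-first)

  graph-twoConnected : TwoConnected graph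
  graph-twoConnected = twoConnected graph (s≤s (s≤s (s≤s z≤n)))
    (on-vertices _ (λ i₀ x₀ u v u≢ v≢ → let open Avoiding i₀ x₀ in
      reach-trans (reached-all u u≢) (reach-sym (reached-all v v≢))))

-- Choosing the number of Petersen gadgets

kindOf : ℕ → ∀ {k} → Fin k → Kind
kindOf a i = if toℕ i <ᵇ a then petersen else ladder

-- Each Petersen gadget loses 6 of its 30 half-edges; the additive form avoids truncated
-- subtraction.
total-kindOf : ∀ {a k} → a ≤ k → sum {k} (λ i → capacity (kindOf a i)) + 6 * a ≡ 30 * k
total-kindOf {zero} {k} z≤n = trans (+-identityʳ _) (trans (sum-const k 30) (*-comm k 30))
total-kindOf {suc a} {suc k} (s≤s a≤k) = begin
  24 + s + 6 * suc a      ≡⟨ solve 2 (λ s a → con 24 :+ s :+ con 6 :* (con 1 :+ a) := con 30 :+ (s :+ con 6 :* a)) refl s a ⟩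
  30 + (s + 6 * a)        ≡⟨ cong (30 +_) (total-kindOf a≤k) ⟩
  30 + 30 * k             ≡⟨ *-suc 30 k ⟨
  30 * suc k              ∎
  where
  open ≡-Reasoning
  open +-*-Solver
  s = sum {k} (λ i → capacity (kindOf a i))

-- Here d stands for q - p. The 5dt Petersen gadgets lose 30dt of the 30(p + d)t half-edges, and
-- 30pt remain. Keeping k a variable with an equation allows it to be matched as 2 + k′.
ring-with-m3 : ∀ p d t k → k ≡ (p + d) * t → 5 * d * t ≤ k → 2 ≤ k →
  Σ Graph (λ G → n G ≡ k * 10 × Cubic G × TwoConnected G × m3≡ G p (p + d))
ring-with-m3 p d t (suc (suc k′)) k≡ a≤k (s≤s (s≤s _)) =
  graph , refl , cubic , graph-twoConnected ,
  (best 0F , best 1F , best 2F , *-cancelˡ-≡ _ _ 2 (trans (lhs (best 0F) (best 1F) (best 2F))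
     (trans (cong (_* (p + d)) union≡total) (≡.sym rhs)))) ,
  λ 𝓜₁ 𝓜₂ 𝓜₃ → *-cancelˡ-≤ 2 (≤-trans (≤-reflexive (lhs 𝓜₁ 𝓜₂ 𝓜₃))
     (≤-trans (*-monoˡ-≤ (p + d) (union≤total 𝓜₁ 𝓜₂ 𝓜₃)) (≤-reflexive (≡.sym rhs))))
  where
  a = 5 * d * t
  open Ring {k′} (kindOf a)
  open FromRotation rotation
  open +-*-Solver

  lhs : ∀ 𝓜₁ 𝓜₂ 𝓜₃ → 2 * (unionSize graph 𝓜₁ 𝓜₂ 𝓜₃ * (p + d)) ≡ 2 * unionSize graph 𝓜₁ 𝓜₂ 𝓜₃ * (p + d)
  lhs 𝓜₁ 𝓜₂ 𝓜₃ = ≡.sym (*-assoc 2 (unionSize graph 𝓜₁ 𝓜₂ 𝓜₃) (p + d))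

  total≡ : total ≡ 30 * p * t
  total≡ = +-cancelʳ-≡ (6 * a) total (30 * p * t) (trans (total-kindOf a≤k)
    (trans (cong (30 *_) k≡)
      (solve 3 (λ p d t → con 30 :* ((p :+ d) :* t) := con 30 :* p :* t :+ con 6 :* (con 5 :* d :* t)) refl p d t)))

  rhs : 2 * (p * numEdges graph) ≡ total * (p + d)
  rhs = let e = numEdges graph in begin
    2 * (p * e)                ≡⟨ solve 2 (λ p e → con 2 :* (p :* e) := p :* (con 2 :* e)) refl p e ⟩
    p * (2 * e)                ≡⟨ cong (p *_) double-numEdges ⟩
    p * (k * 10 * 3)           ≡⟨ cong (λ l → p * (l * 10 * 3)) {k} k≡ ⟩
    p * ((p + d) * t * 10 * 3) ≡⟨ solve 3 (λ p q t → p :* (q :* t :* con 10 :* con 3) := con 30 :* p :* t :* q) refl p (p + d) t ⟩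
    30 * p * t * (p + d)       ≡⟨ cong (_* (p + d)) total≡ ⟨
    total * (p + d)            ∎
    where open ≡-Reasoning

-- Infinitude is expressed by unbounded order: graphs with at least N vertices exist for every N.
theorem1 : (p q : ℕ) → 0 < q → 4 * q ≤ 5 * p → p < q →
    (N : ℕ) → Σ Graph (λ G → (N ≤ n G) × Cubic G × TwoConnected G × m3≡ G p q)
theorem1 zero (suc q) _ () _ N
theorem1 p@(suc _) q 0<q 4q≤5p p<q N =
  subst (λ q → Σ Graph (λ G → (N ≤ n G) × Cubic G × TwoConnected G × m3≡ G p q)) p+d≡q
    -- Taking t = N + 1 keeps t positive and makes the order 10q(N + 1) at least N.
    (let G , n≡ , rest = ring-with-m3 p d (suc N) ((p + d) * suc N) refl (*-monoˡ-≤ (suc N) 5d≤q) 2≤k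
     in G , ≤-trans N≤k*10 (≤-reflexive (≡.sym n≡)) , rest)
  where
  d = q ∸ p
  p+d≡q : p + d ≡ q
  p+d≡q = m+[n∸m]≡n (<⇒≤ p<q)
  -- Cancel 4p in 4(p + d) ≤ 5p. This is where p/q ≥ 4/5 enters: it makes 5dt Petersen gadgets fit
  -- among qt gadgets.
  4d≤p : 4 * d ≤ p
  4d≤p = +-cancelˡ-≤ (4 * p) (4 * d) p (≤-trans (≤-reflexive (trans (≡.sym (*-distribˡ-+ 4 p d)) (cong (4 *_) p+d≡q)))
    (≤-trans 4q≤5p (≤-reflexive (+-comm p (4 * p)))))
  5d≤q : 5 * d ≤ p + d
  5d≤q = ≤-trans (≤-reflexive (+-comm d (4 * d))) (+-monoˡ-≤ d 4d≤p)
  -- Since p is positive and p < q, q is at least 2.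
  2≤k : 2 ≤ (p + d) * suc N
  2≤k = ≤-trans (≤-trans (s≤s (s≤s z≤n)) (subst (p <_) (≡.sym p+d≡q) p<q)) (m≤m*n (p + d) (suc N))
  N≤k*10 : N ≤ (p + d) * suc N * 10
  N≤k*10 = ≤-trans (≤-trans (n≤1+n N) (m≤n*m (suc N) (p + d))) (m≤m*n ((p + d) * suc N) 10)
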